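{- Consider the translation from $\mathsf{CL}_{\rm b}$ to $\mathsf{CLL}_{\rm b}$ obtained by composing the Kuroda translation $(\cdot)^{\rm Ku}$ with Girard's call-by-value translation $(\cdot)^*$, i.e. $A\mapsto(A^{\rm Ku})^*$. This composition can be presented directly in a modular (and simpler) way as $A\mapsto\,!?A_{{\rm Ku}*}$, i.e. for every formula $A$ of the language of $\mathsf{ILL}_\bot$ the formulas $(A^{\rm Ku})^*$ and $!?A_{{\rm Ku}*}$ are provably equivalent in $\mathsf{CLL}_{\rm b}$, where $A_{{\rm Ku}*}$ is defined inductively by: $P_{{\rm Ku}*}:=\,!P$ for $P$ atomic; $(A\otimes B)_{{\rm Ku}*}:=A_{{\rm Ku}*}\otimes B_{{\rm Ku}*}$; $(A\& B)_{{\rm Ku}*}:=\,!(A_{{\rm Ku}*}\& B_{{\rm Ku}*})$; $(A\oplus B)_{{\rm Ku}*}:=A_{{\rm Ku}*}\oplus B_{{\rm Ku}*}$; $(A\multimap B)_{{\rm Ku}*}:=\,!(A_{{\rm Ku}*}\multimap B_{{\rm Ku}*})$; $(\forall xA)_{{\rm Ku}*}:=\,!\forall x\,?A_{{\rm Ku}*}$; $(\exists xA)_{{\rm Ku}*}:=\exists xA_{{\rm Ku}*}$; $(!A)_{{\rm Ku}*}:=\,!A_{{\rm Ku}*}$.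
   Context: Intuitionistic linear logic $\mathsf{ILL}$ (first order). Formulas are built from atomic formulas, including the constants $1,\top,0$, using $\otimes,\&,\oplus,\multimap$, $\forall x,\exists x$ and $!$. Sequents are $\Gamma\vdash A$ with $\Gamma$ a finite multiset of formulas and exactly one formula on the right. Axioms: $A\vdash A$; $\vdash 1$; $\Gamma\vdash\top$; $\Gamma,0\vdash C$. Rules (premises $\Rightarrow$ conclusion): (cut) $\Gamma\vdash A;\ \Delta,A\vdash C\Rightarrow\Gamma,\Delta\vdash C$; $\Gamma\vdash C\Rightarrow\Gamma,1\vdash C$; $\Gamma\vdash A;\ \Delta\vdash B\Rightarrow\Gamma,\Delta\vdash A\otimes B$; $\Gamma,A,B\vdash C\Rightarrow\Gamma,A\otimes B\vdash C$; $\Gamma,A\vdash B\Rightarrow\Gamma\vdash A\multimap B$; $\Gamma\vdash A;\ \Delta,B\vdash C\Rightarrow\Gamma,\Delta,A\multimap B\vdash C$; $\Gamma\vdash A;\ \Gamma\vdash B\Rightarrow\Gamma\vdash A\& B$; $\Gamma,A\vdash C\Rightarrow\Gamma,A\& B\vdash C$; $\Gamma,B\vdash C\Rightarrow\Gamma,A\& B\vdash C$; $\Gamma\vdash A\Rightarrow\Gamma\vdash A\oplus B$; $\Gamma\vdash B\Rightarrow\Gamma\vdash A\oplus B$; $\Gamma,A\vdash C;\ \Gamma,B\vdash C\Rightarrow\Gamma,A\oplus B\vdash C$; $\Gamma\vdash A\Rightarrow\Gamma\vdash\forall xA$; $\Gamma,A[t/x]\vdash C\Rightarrow\Gamma,\forall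 xA\vdash C$; $\Gamma\vdash A[t/x]\Rightarrow\Gamma\vdash\exists xA$; $\Gamma,A\vdash C\Rightarrow\Gamma,\exists xA\vdash C$ (usual eigenvariable conditions); $\Gamma,!A,!A\vdash C\Rightarrow\Gamma,!A\vdash C$; $\Gamma\vdash C\Rightarrow\Gamma,!A\vdash C$; $!\Gamma\vdash A\Rightarrow\,!\Gamma\vdash\,!A$; $\Gamma,A\vdash C\Rightarrow\Gamma,!A\vdash C$. $\mathsf{ILL}_\bot$ extends $\mathsf{ILL}$ by one more constant $\bot$ (also counted as atomic); its sequents have at most one formula on the right (so $C$ in the rules above may be absent), and it has the additional axiom $\bot\vdash$ and rule $\Gamma\vdash\ \Rightarrow\Gamma\vdash\bot$. $\neg A:=A\multimap\bot$ and $?A:=\neg\,!\,\neg A$. $\mathsf{PRO}$: $A\vdash\,!A$; $\mathsf{DNE}$: $\neg\neg A\vdash A$ (axiom schemas). $\mathsf{CLL}_{\rm b}:=\mathsf{ILL}_\bot+\mathsf{DNE}$; $\mathsf{CL}_{\rm b}:=\mathsf{ILL}_\bot+\mathsf{PRO}+\mathsf{DNE}$. Formulas $A,B$ are provably equivalent in $S$ if $S$ proves $(A\multimap B)\&(B\multimap A)$. Kuroda translation: $A^{\rm Ku}:=\neg\neg A_{\rm Ku}$ where $P_{\rm Ku}:=P$ ($P$ atomic); $(A\,\square\,B)_{\rm Ku}:=A_{\rm Ku}\,\square\,B_{\rm Ku}$ for $\square\in\{\otimes,\&,\oplus,\multimap\}$; $(\forall xA)_{\rm Ku}:=\forall x\,\neg\neg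 A_{\rm Ku}$; $(\exists xA)_{\rm Ku}:=\exists xA_{\rm Ku}$; $(!A)_{\rm Ku}:=\,!A_{\rm Ku}$. Call-by-value translation: $P^*:=\,!P$ ($P$ atomic, including $\bot$); $(A\otimes B)^*:=A^*\otimes B^*$; $(A\& B)^*:=\,!(A^*\& B^*)$; $(A\oplus B)^*:=A^*\oplus B^*$; $(A\multimap B)^*:=\,!(A^*\multimap B^*)$; $(\forall xA)^*:=\,!\forall xA^*$; $(\exists xA)^*:=\exists xA^*$; $(!A)^*:=\,!A^*$. -}

module Defs where

open import Data.List using (List; []; _∷_; [_]; _++_; map)
open import Data.List.Relation.Binary.Permutation.Propositional using (_↭_)
open import Data.Maybe as Maybe using (Maybe; just; nothing)
open import Data.Nat using (ℕ; zero; suc)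
open import Data.Vec using (Vec; []; _∷_)

infixr 5 _⊸_
infixr 6 _⊕_
infixr 7 _&_
infixr 8 _⊗_
infix  9 !_ ∀′_ ∃′_
infix  2 _∣_⊢_
infix  2 _≈[_]_

record Signature : Set₁ where
  field
    Fun    : Set
    Pred   : Set
    arityF : Fun → ℕ
    arityP : Pred → ℕ

open Signature

-- Variables are de Bruijn indices ranging over all of ℕ: an index not
-- captured by a quantifier is a free variable, so formulas are formulas up
-- to α-equivalence over an infinite supply of variables.

data Term (𝓛 : Signature) : Set where
  var : ℕ → Term 𝓛
  fun : (f : Fun 𝓛) → Vec (Term 𝓛) (arityF 𝓛 f) → Term 𝓛

data Atom (𝓛 : Signature) : Set where
  rel         : (P : Pred 𝓛) → Vec (Term 𝓛) (arityP 𝓛 P) → Atom 𝓛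
  𝟏 ⊤′ 𝟎 ⊥′   : Atom 𝓛

data Formula (𝓛 : Signature) : Set where
  atom            : Atom 𝓛 → Formula 𝓛
  _⊗_ _&_ _⊕_ _⊸_ : Formula 𝓛 → Formula 𝓛 → Formula 𝓛
  ∀′_ ∃′_ !_      : Formula 𝓛 → Formula 𝓛

module _ {𝓛 : Signature} where

  infix  9 ¬_ ⁇_
  infix 10 _⟨_⟩

  ¬_ : Formula 𝓛 → Formula 𝓛
  ¬ A = A ⊸ atom ⊥′

  ⁇_ : Formula 𝓛 → Formula 𝓛
  ⁇ A = ¬ (! (¬ A))

  Subst : Set
  Subst = ℕ → Term 𝓛

  mutual
    substTerm : Subst → Term 𝓛 → Term 𝓛
    substTerm σ (var i)    = σ i
    substTerm σ (fun f ts) = fun f (substTerms σ ts)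

    substTerms : ∀ {n} → Subst → Vec (Term 𝓛) n → Vec (Term 𝓛) n
    substTerms σ []       = []
    substTerms σ (t ∷ ts) = substTerm σ t ∷ substTerms σ ts

  shift : Subst
  shift i = var (suc i)

  lift : Subst → Subst
  lift σ zero    = var zero
  lift σ (suc i) = substTerm shift (σ i)

  substAtom : Subst → Atom 𝓛 → Atom 𝓛
  substAtom σ (rel P ts) = rel P (substTerms σ ts)
  substAtom σ 𝟏          = 𝟏
  substAtom σ ⊤′         = ⊤′
  substAtom σ 𝟎          = 𝟎
  substAtom σ ⊥′         = ⊥′

  subst : Subst → Formula 𝓛 → Formula 𝓛
  subst σ (atom P) = atom (substAtom σ P)
  subst σ (A ⊗ B)  = subst σ A ⊗ subst σ B
  subst σ (A & B)  = subst σ A & subst σ B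
  subst σ (A ⊕ B)  = subst σ A ⊕ subst σ B
  subst σ (A ⊸ B)  = subst σ A ⊸ subst σ B
  subst σ (∀′ A)   = ∀′ subst (lift σ) A
  subst σ (∃′ A)   = ∃′ subst (lift σ) A
  subst σ (! A)    = ! subst σ A

  weaken : Formula 𝓛 → Formula 𝓛
  weaken = subst shift

  instantiate : Term 𝓛 → Subst
  instantiate t zero    = t
  instantiate t (suc i) = var i

  -- A[t/x], where x is the variable bound by the quantifier just removed.
  _⟨_⟩ : Formula 𝓛 → Term 𝓛 → Formula 𝓛
  A ⟨ t ⟩ = subst (instantiate t) A

-- Axiom schemas of the form A ⊢ B, given as the set of their instances.
Schema : Signature → Set₁
Schema 𝓛 = Formula 𝓛 → Formula 𝓛 → Set

Calculus : Signature → Set₁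
Calculus 𝓛 = List (Formula 𝓛) → Maybe (Formula 𝓛) → Set

-- S ∣ Γ ⊢ C: derivability of Γ ⊢ C in ILL⊥ extended by the schema S.
-- `exch` makes antecedents multisets; `nothing` is the empty succedent.
-- In ∀R and ∃L the eigenvariable is index 0, which is fresh for the weakened
-- side formulas.
data _∣_⊢_ {𝓛 : Signature} (S : Schema 𝓛) : Calculus 𝓛 where
  schema : ∀ {A B} → S A B → S ∣ [ A ] ⊢ just B
  exch   : ∀ {Γ Δ C} → Γ ↭ Δ → S ∣ Γ ⊢ C → S ∣ Δ ⊢ C

  ax  : ∀ {A} → S ∣ [ A ] ⊢ just A
  cut : ∀ {Γ Δ A C} → S ∣ Γ ⊢ just A → S ∣ A ∷ Δ ⊢ C → S ∣ Γ ++ Δ ⊢ C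

  1R : S ∣ [] ⊢ just (atom 𝟏)
  1L : ∀ {Γ C} → S ∣ Γ ⊢ C → S ∣ atom 𝟏 ∷ Γ ⊢ C
  ⊤R : ∀ {Γ} → S ∣ Γ ⊢ just (atom ⊤′)
  0L : ∀ {Γ C} → S ∣ atom 𝟎 ∷ Γ ⊢ C
  ⊥L : S ∣ [ atom ⊥′ ] ⊢ nothing
  ⊥R : ∀ {Γ} → S ∣ Γ ⊢ nothing → S ∣ Γ ⊢ just (atom ⊥′)

  ⊗R : ∀ {Γ Δ A B} → S ∣ Γ ⊢ just A → S ∣ Δ ⊢ just B → S ∣ Γ ++ Δ ⊢ just (A ⊗ B)
  ⊗L : ∀ {Γ A B C} → S ∣ A ∷ B ∷ Γ ⊢ C → S ∣ A ⊗ B ∷ Γ ⊢ C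

  ⊸R : ∀ {Γ A B} → S ∣ A ∷ Γ ⊢ just B → S ∣ Γ ⊢ just (A ⊸ B)
  ⊸L : ∀ {Γ Δ A B C} → S ∣ Γ ⊢ just A → S ∣ B ∷ Δ ⊢ C → S ∣ (A ⊸ B) ∷ Γ ++ Δ ⊢ C

  &R  : ∀ {Γ A B} → S ∣ Γ ⊢ just A → S ∣ Γ ⊢ just B → S ∣ Γ ⊢ just (A & B)
  &L₁ : ∀ {Γ A B C} → S ∣ A ∷ Γ ⊢ C → S ∣ A & B ∷ Γ ⊢ C
  &L₂ : ∀ {Γ A B C} → S ∣ B ∷ Γ ⊢ C → S ∣ A & B ∷ Γ ⊢ C

  ⊕R₁ : ∀ {Γ A B} → S ∣ Γ ⊢ just A → S ∣ Γ ⊢ just (A ⊕ B)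
  ⊕R₂ : ∀ {Γ A B} → S ∣ Γ ⊢ just B → S ∣ Γ ⊢ just (A ⊕ B)
  ⊕L  : ∀ {Γ A B C} → S ∣ A ∷ Γ ⊢ C → S ∣ B ∷ Γ ⊢ C → S ∣ A ⊕ B ∷ Γ ⊢ C

  ∀R : ∀ {Γ A} → S ∣ map weaken Γ ⊢ just A → S ∣ Γ ⊢ just (∀′ A)
  ∀L : ∀ {Γ A C} (t : Term 𝓛) → S ∣ A ⟨ t ⟩ ∷ Γ ⊢ C → S ∣ ∀′ A ∷ Γ ⊢ C
  ∃R : ∀ {Γ A} (t : Term 𝓛) → S ∣ Γ ⊢ just (A ⟨ t ⟩) → S ∣ Γ ⊢ just (∃′ A)
  ∃L : ∀ {Γ A C} → S ∣ A ∷ map weaken Γ ⊢ Maybe.map weaken C → S ∣ ∃′ A ∷ Γ ⊢ C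

  !C : ∀ {Γ A C} → S ∣ ! A ∷ ! A ∷ Γ ⊢ C → S ∣ ! A ∷ Γ ⊢ C
  !W : ∀ {Γ A C} → S ∣ Γ ⊢ C → S ∣ ! A ∷ Γ ⊢ C
  !R : ∀ {Γ A} → S ∣ map !_ Γ ⊢ just A → S ∣ map !_ Γ ⊢ just (! A)
  !L : ∀ {Γ A C} → S ∣ A ∷ Γ ⊢ C → S ∣ ! A ∷ Γ ⊢ C

data DNE {𝓛 : Signature} : Schema 𝓛 where
  dne : ∀ A → DNE (¬ (¬ A)) A

CLLb : ∀ {𝓛} → Calculus 𝓛
CLLb Γ C = DNE ∣ Γ ⊢ C

_≈[_]_ : ∀ {𝓛} → Formula 𝓛 → Calculus 𝓛 → Formula 𝓛 → Set
A ≈[ K ] B = K [] (just ((A ⊸ B) & (B ⊸ A)))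

module _ {𝓛 : Signature} where

  infix 10 _ᴷᵘ _ₖᵤ _^* _ₖᵤ*

  _ₖᵤ : Formula 𝓛 → Formula 𝓛
  (atom P) ₖᵤ = atom P
  (A ⊗ B)  ₖᵤ = A ₖᵤ ⊗ B ₖᵤ
  (A & B)  ₖᵤ = A ₖᵤ & B ₖᵤ
  (A ⊕ B)  ₖᵤ = A ₖᵤ ⊕ B ₖᵤ
  (A ⊸ B)  ₖᵤ = A ₖᵤ ⊸ B ₖᵤ
  (∀′ A)   ₖᵤ = ∀′ (¬ (¬ (A ₖᵤ)))
  (∃′ A)   ₖᵤ = ∃′ (A ₖᵤ)
  (! A)    ₖᵤ = ! (A ₖᵤ)

  _ᴷᵘ : Formula 𝓛 → Formula 𝓛
  A ᴷᵘ = ¬ (¬ (A ₖᵤ))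

  _^* : Formula 𝓛 → Formula 𝓛
  (atom P) ^* = ! (atom P)
  (A ⊗ B)  ^* = A ^* ⊗ B ^*
  (A & B)  ^* = ! (A ^* & B ^*)
  (A ⊕ B)  ^* = A ^* ⊕ B ^*
  (A ⊸ B)  ^* = ! (A ^* ⊸ B ^*)
  (∀′ A)   ^* = ! (∀′ (A ^*))
  (∃′ A)   ^* = ∃′ (A ^*)
  (! A)    ^* = ! (A ^*)

  _ₖᵤ* : Formula 𝓛 → Formula 𝓛
  (atom P) ₖᵤ* = ! (atom P)
  (A ⊗ B)  ₖᵤ* = A ₖᵤ* ⊗ B ₖᵤ*
  (A & B)  ₖᵤ* = ! (A ₖᵤ* & B ₖᵤ*)
  (A ⊕ B)  ₖᵤ* = A ₖᵤ* ⊕ B ₖᵤ*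
  (A ⊸ B)  ₖᵤ* = ! (A ₖᵤ* ⊸ B ₖᵤ*)
  (∀′ A)   ₖᵤ* = ! (∀′ (⁇ (A ₖᵤ*)))
  (∃′ A)   ₖᵤ* = ∃′ (A ₖᵤ*)
  (! A)    ₖᵤ* = ! (A ₖᵤ*)

{-# OPTIONS --safe #-}
-- Both translations of A turn out to be equivalent already in ILL⊥.  Every
-- formula Q = B^* is a coalgebra, Q ⊢ !Q, so !(Q ⊸ !P) and !(Q ⊸ P) are
-- interderivable: in !(Q ⊸ P), Q ⊢ P the whole antecedent can be promoted.
-- Applied to the two negations in (¬¬B)^* = !(!(B^* ⊸ !⊥) ⊸ !⊥) this gives
-- !?(B^*), and it remains to compare (A_Ku)^* with A_Ku* by induction, where
-- only ∀ needs an argument: !∀x!Z and !∀xZ are interderivable.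
module Submission where

open import Defs
open import Data.List using ([]; _∷_; [_])
open import Data.List.Relation.Binary.Permutation.Propositional using (swap; ↭-refl)
open import Data.Maybe using (just)
open import Data.Nat using (zero; suc)
open import Data.Product using (_×_; _,_; proj₁; proj₂; map; zip)
open import Data.Vec using (Vec; []; _∷_)
open import Relation.Binary.PropositionalEquality
  using (_≡_; refl; sym; trans; cong; cong₂; module ≡-Reasoning)
  renaming (subst to transport)

module _ {𝓛 : Signature} where

  mutual
    -- The composite enters as any `ρ` agreeing pointwise, so that no two substitutions ever have to
    -- be equal as functions.
    substTerm-∘ : ∀ {σ τ ρ : Subst {𝓛}} → (∀ i → substTerm σ (τ i) ≡ ρ i) →
                  ∀ t → substTerm σ (substTerm τ t) ≡ substTerm ρ t
    substTerm-∘ eq (var i)    = eq i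
    substTerm-∘ eq (fun f ts) = cong (fun f) (substTerms-∘ eq ts)

    substTerms-∘ : ∀ {σ τ ρ : Subst {𝓛}} → (∀ i → substTerm σ (τ i) ≡ ρ i) →
                   ∀ {n} (ts : Vec (Term 𝓛) n) →
                   substTerms σ (substTerms τ ts) ≡ substTerms ρ ts
    substTerms-∘ eq []       = refl
    substTerms-∘ eq (t ∷ ts) = cong₂ _∷_ (substTerm-∘ eq t) (substTerms-∘ eq ts)

  mutual
    substTerm-var : (t : Term 𝓛) → substTerm var t ≡ t
    substTerm-var (var i)    = refl
    substTerm-var (fun f ts) = cong (fun f) (substTerms-var ts)

    substTerms-var : ∀ {n} (ts : Vec (Term 𝓛) n) → substTerms var ts ≡ ts
    substTerms-var []       = refl
    substTerms-var (t ∷ ts) = cong₂ _∷_ (substTerm-var t) (substTerms-var ts)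

  infix 4 _LeftInverseOf_

  _LeftInverseOf_ : Subst {𝓛} → Subst {𝓛} → Set
  σ LeftInverseOf τ = ∀ i → substTerm σ (τ i) ≡ var i

  -- Carries the induction of `subst-leftInverse` under a binder.
  lift-leftInverse : ∀ {σ τ} → σ LeftInverseOf τ → lift σ LeftInverseOf lift τ
  lift-leftInverse         inv zero    = refl
  lift-leftInverse {σ} {τ} inv (suc i) = begin
    -- `lift σ` after `shift` and `shift` after `σ` have the same composite, which moves the shift
    -- outside so that `inv i` applies.
    substTerm (lift σ) (substTerm shift (τ i))  ≡⟨ substTerm-∘ (λ _ → refl) (τ i) ⟩
    substTerm (λ j → substTerm shift (σ j)) (τ i)  ≡⟨ substTerm-∘ (λ _ → refl) (τ i) ⟨
    substTerm shift (substTerm σ (τ i))         ≡⟨ cong (substTerm shift) (inv i) ⟩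
    var (suc i)                                 ∎
    where open ≡-Reasoning

  subst-leftInverse : ∀ {σ τ} → σ LeftInverseOf τ →
                      (A : Formula 𝓛) → subst σ (subst τ A) ≡ A
  subst-leftInverse inv (atom (rel P ts)) =
    cong (λ us → atom (rel P us)) (trans (substTerms-∘ inv ts) (substTerms-var ts))
  subst-leftInverse inv (atom 𝟏)  = refl
  subst-leftInverse inv (atom ⊤′) = refl
  subst-leftInverse inv (atom 𝟎)  = refl
  subst-leftInverse inv (atom ⊥′) = refl
  subst-leftInverse inv (A ⊗ B) = cong₂ _⊗_ (subst-leftInverse inv A) (subst-leftInverse inv B)
  subst-leftInverse inv (A & B) = cong₂ _&_ (subst-leftInverse inv A) (subst-leftInverse inv B)
  subst-leftInverse inv (A ⊕ B) = cong₂ _⊕_ (subst-leftInverse inv A) (subst-leftInverse inv B)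
  subst-leftInverse inv (A ⊸ B) = cong₂ _⊸_ (subst-leftInverse inv A) (subst-leftInverse inv B)
  subst-leftInverse inv (∀′ A)  = cong ∀′_ (subst-leftInverse (lift-leftInverse inv) A)
  subst-leftInverse inv (∃′ A)  = cong ∃′_ (subst-leftInverse (lift-leftInverse inv) A)
  subst-leftInverse inv (! A)   = cong !_ (subst-leftInverse inv A)

  -- The left-hand side arises when the body A of a weakened quantified formula
  -- is instantiated with the eigenvariable.
  instantiate-lift-shift : (A : Formula 𝓛) → subst (lift shift) A ⟨ var zero ⟩ ≡ A
  instantiate-lift-shift = subst-leftInverse λ { zero → refl ; (suc i) → refl }

module _ {𝓛 : Signature} {S : Schema 𝓛} where

  infix 2 _⊩_ _⊣⊢_

  _⊩_ : Formula 𝓛 → Formula 𝓛 → Set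
  A ⊩ B = S ∣ [ A ] ⊢ just B

  _⊣⊢_ : Formula 𝓛 → Formula 𝓛 → Set
  A ⊣⊢ B = (A ⊩ B) × (B ⊩ A)

  private variable
    A A′ B B′ C P Q : Formula 𝓛

  ⊩-trans : A ⊩ B → B ⊩ C → A ⊩ C
  ⊩-trans = cut

  ⊣⊢-refl : A ⊣⊢ A
  ⊣⊢-refl = ax , ax

  ⊣⊢-trans : A ⊣⊢ B → B ⊣⊢ C → A ⊣⊢ C
  ⊣⊢-trans (p , p′) (q , q′) = ⊩-trans p q , ⊩-trans q′ p′

  exch₂ : ∀ {C} → S ∣ A ∷ B ∷ [] ⊢ C → S ∣ B ∷ A ∷ [] ⊢ C
  exch₂ = exch (swap _ _ ↭-refl)

  promote : ! A ⊩ B → ! A ⊩ ! B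
  promote {A} = !R {Γ = [ A ]}

  promote₂ : S ∣ ! A ∷ ! B ∷ [] ⊢ just C → S ∣ ! A ∷ ! B ∷ [] ⊢ just (! C)
  promote₂ {A} {B} = !R {Γ = A ∷ B ∷ []}

  derelict : ! A ⊩ A
  derelict = !L ax

  derelict₂ : ∀ {C} → S ∣ A ∷ B ∷ [] ⊢ C → S ∣ ! A ∷ ! B ∷ [] ⊢ C
  derelict₂ d = exch₂ (!L (exch₂ (!L d)))

  -- ∀L and ∃R with the eigenvariable of an enclosing ∀R or ∃L as witness.
  ∀L-eigen : A ⊩ B → weaken (∀′ A) ⊩ B
  ∀L-eigen {A} {B} d =
    ∀L (var zero) (transport (_⊩ B) (sym (instantiate-lift-shift A)) d)

  ∃R-eigen : A ⊩ B → A ⊩ weaken (∃′ B)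
  ∃R-eigen {A} {B} d =
    ∃R (var zero) (transport (A ⊩_) (sym (instantiate-lift-shift B)) d)

  ⊗-mono : A ⊩ A′ → B ⊩ B′ → A ⊗ B ⊩ A′ ⊗ B′
  ⊗-mono p q = ⊗L (⊗R p q)

  &-mono : A ⊩ A′ → B ⊩ B′ → A & B ⊩ A′ & B′
  &-mono p q = &R (&L₁ p) (&L₂ q)

  ⊕-mono : A ⊩ A′ → B ⊩ B′ → A ⊕ B ⊩ A′ ⊕ B′
  ⊕-mono p q = ⊕L (⊕R₁ p) (⊕R₂ q)

  ⊸-mono : A′ ⊩ A → B ⊩ B′ → A ⊸ B ⊩ A′ ⊸ B′
  ⊸-mono p q = ⊸R (exch₂ (⊸L p q))

  !-mono : A ⊩ B → ! A ⊩ ! B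
  !-mono p = promote (!L p)

  ∀-mono : A ⊩ B → ∀′ A ⊩ ∀′ B
  ∀-mono p = ∀R (∀L-eigen p)

  ∃-mono : A ⊩ B → ∃′ A ⊩ ∃′ B
  ∃-mono p = ∃L (∃R-eigen p)

  ⊸-cong : A ⊣⊢ A′ → B ⊣⊢ B′ → A ⊸ B ⊣⊢ A′ ⊸ B′
  ⊸-cong (p , p′) (q , q′) = ⊸-mono p′ q , ⊸-mono p q′

  !-cong : A ⊣⊢ B → ! A ⊣⊢ ! B
  !-cong = map !-mono !-mono

  ¬-cong : A ⊣⊢ B → ¬ A ⊣⊢ ¬ B
  ¬-cong p = ⊸-cong p ⊣⊢-refl

  ⁇-cong : A ⊣⊢ B → ⁇ A ⊣⊢ ⁇ B
  ⁇-cong p = ¬-cong (!-cong (¬-cong p))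

  Coalgebra : Formula 𝓛 → Set
  Coalgebra A = A ⊩ ! A

  !-coalgebra : Coalgebra (! A)
  !-coalgebra = promote ax

  -- Cutting with `a` and `b` turns the antecedent into `! A , ! B`, from which `A ⊗ B` can be
  -- promoted.
  ⊗-coalgebra : Coalgebra A → Coalgebra B → Coalgebra (A ⊗ B)
  ⊗-coalgebra a b =
    ⊗L (cut a (exch₂ (cut b (exch₂ (promote₂ (derelict₂ (⊗R ax ax)))))))

  ⊕-coalgebra : Coalgebra A → Coalgebra B → Coalgebra (A ⊕ B)
  ⊕-coalgebra a b = ⊕L (⊩-trans a (!-mono (⊕R₁ ax))) (⊩-trans b (!-mono (⊕R₂ ax)))

  ∃-coalgebra : Coalgebra A → Coalgebra (∃′ A)
  ∃-coalgebra a = ∃L (⊩-trans a (!-mono (∃R-eigen ax)))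

  -- A clause of `_^*` either yields an outermost `!` or keeps one of `⊗`, `⊕`, `∃′`, under which
  -- coalgebras are closed.
  ^*-coalgebra : (A : Formula 𝓛) → Coalgebra (A ^*)
  ^*-coalgebra (atom P) = !-coalgebra
  ^*-coalgebra (A ⊗ B)  = ⊗-coalgebra (^*-coalgebra A) (^*-coalgebra B)
  ^*-coalgebra (A & B)  = !-coalgebra
  ^*-coalgebra (A ⊕ B)  = ⊕-coalgebra (^*-coalgebra A) (^*-coalgebra B)
  ^*-coalgebra (A ⊸ B)  = !-coalgebra
  ^*-coalgebra (∀′ A)   = !-coalgebra
  ^*-coalgebra (∃′ A)   = ∃-coalgebra (^*-coalgebra A)
  ^*-coalgebra (! A)    = !-coalgebra

  !⊸! : Coalgebra Q → ! (Q ⊸ ! P) ⊣⊢ ! (Q ⊸ P)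
  !⊸! q = !-mono (⊸-mono ax derelict)
        , promote (⊸R (cut q (promote₂ (derelict₂ (exch₂ (⊸L ax ax))))))

  -- From right to left, the antecedent is still a `!` formula after `∀R`, so the generic instance
  -- can be promoted before `∀L` opens the quantifier.
  !∀! : ! (∀′ (! A)) ⊣⊢ ! (∀′ A)
  !∀! = !-mono (∀-mono derelict) , promote (∀R (promote (!L (∀L-eigen ax))))

  ¬¬-^* : (B : Formula 𝓛) → (¬ (¬ B)) ^* ⊣⊢ ! (⁇ (B ^*))
  -- The outer negation loses its `!` on `⊥′` first, its argument being a `!` formula; the inner one
  -- follows, with argument `B ^*`.
  ¬¬-^* B = ⊣⊢-trans (!⊸! !-coalgebra) (!-cong (¬-cong (!⊸! (^*-coalgebra B))))

  mutual
    ₖᵤ-^* : (A : Formula 𝓛) → (A ₖᵤ) ^* ⊣⊢ A ₖᵤ*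
    ₖᵤ-^* (atom P) = ⊣⊢-refl
    ₖᵤ-^* (A ⊗ B)  = zip ⊗-mono ⊗-mono (ₖᵤ-^* A) (ₖᵤ-^* B)
    ₖᵤ-^* (A & B)  = !-cong (zip &-mono &-mono (ₖᵤ-^* A) (ₖᵤ-^* B))
    ₖᵤ-^* (A ⊕ B)  = zip ⊕-mono ⊕-mono (ₖᵤ-^* A) (ₖᵤ-^* B)
    ₖᵤ-^* (A ⊸ B)  = !-cong (⊸-cong (ₖᵤ-^* A) (ₖᵤ-^* B))
    -- The body of `(∀′ A) ₖᵤ` is `A ᴷᵘ`, hence the mutual recursion. Its image `! (⁇ (A ₖᵤ*))` has
    -- a `!` directly under `∀′`, which `!∀!` removes.
    ₖᵤ-^* (∀′ A)   = ⊣⊢-trans (!-cong (map ∀-mono ∀-mono (ᴷᵘ-^* A))) !∀!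
    ₖᵤ-^* (∃′ A)   = map ∃-mono ∃-mono (ₖᵤ-^* A)
    ₖᵤ-^* (! A)    = !-cong (ₖᵤ-^* A)

    ᴷᵘ-^* : (A : Formula 𝓛) → (A ᴷᵘ) ^* ⊣⊢ ! (⁇ (A ₖᵤ*))
    ᴷᵘ-^* A = ⊣⊢-trans (¬¬-^* (A ₖᵤ)) (!-cong (⁇-cong (ₖᵤ-^* A)))

theorem4 : (𝓛 : Signature) (A : Formula 𝓛) → ((A ᴷᵘ) ^*) ≈[ CLLb ] (! (⁇ (A ₖᵤ*)))
theorem4 𝓛 A = &R (⊸R (proj₁ (ᴷᵘ-^* A))) (⊸R (proj₂ (ᴷᵘ-^* A)))
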